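{- Any (probabilistic bounded error or deterministic) symbolic algorithm that computes the strongly connected components (SCCs) of a directed graph $G$ needs $\Omega\big(|SCCs(G)|+\sum_{C\in SCCs(G)} D_C\big)$ symbolic one-step operations, where $SCCs(G)$ is the set of SCCs of $G$ and $D_C$ is the diameter of the SCC $C$.
   Context: Symbolic model: the input is a finite directed graph $G=(V,E)$ (self-loops allowed), $n=|V|$. The algorithm knows $V$, but it can access $E$ only through the one-step operations $\mathrm{Pre}(S)=\{v\in V\mid \exists s\in S:(v,s)\in E\}$ and $\mathrm{Post}(S)=\{v\in V\mid \exists s\in S:(s,v)\in E\}$ applied to (adaptively chosen) sets $S\subseteq V$. All other computation, in particular basic set operations such as $\cup,\cap,\setminus,\subseteq,=$ on vertex sets, is unrestricted and not counted in lower bounds; any number of sets may be stored. A probabilistic bounded error algorithm may use random bits and must be correct with probability at least $2/3$ on every input. Convention for lower bounds: "needs $\Omega(g)$ one-step operations", for a parameter $g$ of the input, means: there is an absolute constant $c>0$ such that every (deterministic or probabilistic bounded error) symbolic algorithm solving the problem on all inputs performs, on inputs with arbitrarily large $g$, at least $c\cdot g$ one-step operations (worst case over its random choices). For an SCC $C$, $D_C$ is the diameter of the subgraph induced by $C$, i.e. the maximum distance $d(u,v)$ over $u,v\in C$ (so $D_C=0$ for a single-vertex SCC). -}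

module Defs where

open import Data.Bool using (Bool; T; T?)
open import Data.Fin using (Fin)
open import Data.Fin.Properties using (any?)
open import Data.Fin.Subset using (Subset; _∈_; _⊆_; Nonempty)
open import Data.Fin.Subset.Properties using (_∈?_)
open import Data.Integer using (+_)
open import Data.List using (List; length; sum)
import Data.List.Membership.Propositional as List
open import Data.List.Relation.Binary.Pointwise using (Pointwise)
open import Data.List.Relation.Unary.All using (All)
open import Data.List.Relation.Unary.Unique.Propositional using (Unique)
open import Data.Maybe using (Maybe; just; nothing)
open import Data.Maybe.Relation.Unary.Any using (Any)
open import Data.Nat as ℕ using (ℕ; zero; suc; _^_)
open import Data.Product using (∃; ∃₂; _×_)
open import Data.Rational.Unnormalised as ℚ using (ℚᵘ; _/_)
open import Data.Sum using (_⊎_)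
open import Data.Vec using (Vec; []; _∷_; tabulate)
open import Function using (_⇔_)
open import Level using (0ℓ)
open import Relation.Binary using (Rel)
open import Relation.Binary.Construct.Closure.ReflexiveTransitive using (Star; fold)
open import Relation.Binary.PropositionalEquality using (_≡_; _≢_)
open import Relation.Nullary using (does)
open import Relation.Nullary.Decidable using (_×-dec_)
open import Relation.Unary using (Pred)

------------------------------------------------------------------------
-- Directed graphs and strongly connected components

-- Adjacency matrix; self-loops are allowed.
Graph : ℕ → Set
Graph n = Fin n → Fin n → Bool

Edge : ∀ {n} → Graph n → Rel (Fin n) 0ℓ
Edge G u v = T (G u v)

-- Edge relation of the subgraph induced by C.
InducedEdge : ∀ {n} → Graph n → Subset n → Rel (Fin n) 0ℓ
InducedEdge G C u v = u ∈ C × v ∈ C × Edge G u v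

pathLength : ∀ {n} {R : Rel (Fin n) 0ℓ} {u v} → Star R u v → ℕ
pathLength = fold (λ _ _ → ℕ) (λ _ → suc) 0

StronglyConnected : ∀ {n} → Graph n → Subset n → Set
StronglyConnected G C = ∀ {u v} → u ∈ C → v ∈ C → Star (InducedEdge G C) u v

-- Nonemptiness only matters for the graph without vertices, which has no SCC.
IsSCC : ∀ {n} → Graph n → Subset n → Set
IsSCC G C =
  Nonempty C ×
  StronglyConnected G C ×
  (∀ C′ → StronglyConnected G C′ → C ⊆ C′ → C′ ⊆ C)

-- Cs, read as a set (order and repetitions are irrelevant), is SCCs(G).
EnumeratesSCCs : ∀ {n} → Graph n → List (Subset n) → Set
EnumeratesSCCs G Cs = ∀ C → (C List.∈ Cs) ⇔ IsSCC G C

IsDistance : ∀ {n} → Rel (Fin n) 0ℓ → Fin n → Fin n → ℕ → Set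
IsDistance R u v d =
  (∃ λ (p : Star R u v) → pathLength p ≡ d) ×
  (∀ (p : Star R u v) → d ℕ.≤ pathLength p)

-- D is the maximum of d(u,v) over u, v ∈ C, with distances taken in the
-- subgraph induced by C.
IsDiameter : ∀ {n} → Graph n → Subset n → ℕ → Set
IsDiameter G C D =
  (∃₂ λ u v → u ∈ C × v ∈ C × IsDistance (InducedEdge G C) u v D) ×
  (∀ {u v d} → u ∈ C → v ∈ C → IsDistance (InducedEdge G C) u v d → d ℕ.≤ D)

-- g = |SCCs(G)| + Σ_{C ∈ SCCs(G)} D_C
HasParameter : ∀ {n} → Graph n → ℕ → Set
HasParameter G g = ∃₂ λ Cs Ds →
  Unique Cs ×
  EnumeratesSCCs G Cs ×
  Pointwise (IsDiameter G) Cs Ds ×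
  g ≡ length Cs ℕ.+ sum Ds

------------------------------------------------------------------------
-- Symbolic algorithms

Pre Post : ∀ {n} → Graph n → Subset n → Subset n
Pre  G S = tabulate λ v → does (any? λ s → (s ∈? S) ×-dec T? (G v s))
Post G S = tabulate λ v → does (any? λ s → (s ∈? S) ×-dec T? (G s v))

data Move (n : ℕ) (State : Set) : Set where
  halt     : List (Subset n) → Move n State
  toss     : (Bool → State) → Move n State
  pre post : Subset n → (Subset n → State) → Move n State

-- A symbolic algorithm on the vertex set Fin n, as a transition system.  It
-- sees the edges only through the answers to its pre and post moves.  State
-- and step are arbitrary, so memory and all computation in between are free.
-- Termination is not built in.
record Algorithm (n : ℕ) : Set₁ where
  field
    State : Set
    start : State
    step  : State → Move n State

module Run {n} (G : Graph n) (A : Algorithm n) where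
  open Algorithm A

  -- The first t moves, driven by t fair random bits: bit i is the coin that
  -- move i tosses, and is discarded if move i is not a toss.  Discarding
  -- independent bits does not affect the distribution of a run.
  -- `nothing` means that the algorithm has not halted within t moves.
  resultFrom : ∀ {t} → State → Vec Bool t → Maybe (List (Subset n))
  resultFrom s []      = nothing
  resultFrom s (b ∷ r) with step s
  ... | halt Cs  = just Cs
  ... | toss k   = resultFrom (k b) r
  ... | pre S k  = resultFrom (k (Pre G S)) r
  ... | post S k = resultFrom (k (Post G S)) r

  operationsFrom : ∀ {t} → State → Vec Bool t → ℕ
  operationsFrom s []      = 0
  operationsFrom s (b ∷ r) with step s
  ... | halt _   = 0
  ... | toss k   = operationsFrom (k b) r
  ... | pre S k  = suc (operationsFrom (k (Pre G S)) r)
  ... | post S k = suc (operationsFrom (k (Post G S)) r)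

  Correct : ∀ {t} → Vec Bool t → Set
  Correct r = Any (EnumeratesSCCs G) (resultFrom start r)

  operations : ∀ {t} → Vec Bool t → ℕ
  operations = operationsFrom start

open Run public using (Correct; operations)

fromℕ : ℕ → ℚᵘ
fromℕ k = + k / 1

-- Pr[P r] ≥ p for a uniformly random r ∈ {0,1}ᵗ, i.e. at least p · 2ᵗ
-- distinct strings r satisfy P.
ProbAtLeast : ∀ {t} → ℚᵘ → Pred (Vec Bool t) 0ℓ → Set
ProbAtLeast {t} p P = ∃ λ (rs : List (Vec Bool t)) →
  Unique rs × All P rs × p ℚ.* fromℕ (2 ^ t) ℚ.≤ fromℕ (length rs)

Deterministic : ∀ {n} → Algorithm n → Set
Deterministic A = ∀ s k → step s ≢ toss k
  where open Algorithm A

AlwaysCorrect : ∀ {n} → Algorithm n → Set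
AlwaysCorrect {n} A = ∀ (G : Graph n) →
  ∃ λ t → ∀ (r : Vec Bool t) → Correct G A r

-- The event "halts with a correct output" is the increasing union over t of
-- "halts with a correct output within t moves", so its probability is at
-- least 2/3 iff every p < 2/3 is reached for some t.  No bound on the number
-- of coin tosses is assumed.
BoundedError : ∀ {n} → Algorithm n → Set
BoundedError {n} A = ∀ (G : Graph n) (p : ℚᵘ) → p ℚ.< + 2 / 3 →
  ∃ λ t → ProbAtLeast {t} p (Correct G A)

-- One algorithm for each number n of vertices, correct on all graphs.
ComputesSCCs : (∀ n → Algorithm n) → Set
ComputesSCCs A =
  (∀ n → Deterministic (A n) × AlwaysCorrect (A n)) ⊎
  (∀ n → BoundedError (A n))

-- In the worst case over its random choices, A performs at least q one-step
-- operations on G.  Runs that never halt are covered by their finite prefixes.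
WorstCaseAtLeast : ∀ {n} → Graph n → Algorithm n → ℚᵘ → Set
WorstCaseAtLeast G A q = ∃₂ λ t (r : Vec Bool t) → q ℚ.≤ fromℕ (operations G A r)

{-# OPTIONS --safe #-}

-- Let G be the transitive tournament with all self-loops, whose SCCs are its
-- single vertices, and let H i be G with the back edge (i + 1, i), which merges
-- i and i + 1.  Post (H i) S differs from Post G S only if i + 1 is the least
-- element of S, and Pre (H i) S differs from Pre G S only if i is the greatest
-- element of S.  So each operation of a run on G separates G from at most one
-- H i.  A random string on which the algorithm is correct both for G and for
-- H i must separate the two, and this happens for at least a quarter of the
-- strings.  Hence on average over the strings, and so on some string, the run
-- on G performs at least a quarter as many operations as there are H i.
module Submission where

open import Defs
open import Data.Bool using (Bool; true; false; T?; _∨_; _∧_)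
import Data.Bool.Properties as Bool
open import Data.Bool.Properties using (T-∨; T-∧)
open import Data.Fin as Fin using (Fin; zero; suc; inject₁)
import Data.Fin.Properties as Fin
open import Data.Fin.Properties using (any?)
open import Data.Fin.Subset using (Subset; _∈_; ⁅_⁆; _∪_)
open import Data.Fin.Subset.Properties
  using (_∈?_; x∈⁅x⁆; x∈⁅y⁆⇒x≡y; x∈p∪q⁻; p⊆p∪q; q⊆p∪q; ⊆-antisym)
import Data.Integer as ℤ
import Data.Integer.Properties as ℤ
open import Data.List using (List; []; _∷_; length; map; _++_; allFin)
import Data.List.Membership.Propositional as List
open import Data.List.Membership.Propositional.Properties
  using (∈-map⁺; ∈-map⁻; ∈-++⁺ˡ; ∈-++⁺ʳ; ∈-allFin)
open import Data.List.Properties using (length-map; length-++; length-tabulate)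
open import Data.List.Relation.Binary.Pointwise using (Pointwise; []; _∷_)
open import Data.List.Relation.Unary.All as All using (All; []; _∷_)
import Data.List.Relation.Unary.All.Properties as All
open import Data.List.Relation.Unary.AllPairs using ([]; _∷_)
open import Data.List.Relation.Unary.Any using (here; there)
open import Data.List.Relation.Unary.Unique.Propositional using (Unique)
import Data.List.Relation.Unary.Unique.Propositional.Properties as Unique
import Data.Maybe.Relation.Unary.Any as Maybe
open import Data.Nat using (ℕ; zero; suc; _≤_; _+_; _^_; z≤n; s≤s; _≤′_; ≤′-refl; ≤′-step)
import Data.Nat as ℕ
import Data.Nat.Properties as ℕ
open import Data.Nat.ListAction using (sum)
open import Data.Nat.Tactic.RingSolver using (solve-∀)
open import Data.Product using (∃; ∃₂; _×_; _,_; proj₁; proj₂)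
open import Data.Rational.Unnormalised using (ℚᵘ; 0ℚᵘ; _<_; _*_; mkℚᵘ; _/_; *≤*)
import Data.Rational.Unnormalised as ℚ
import Data.Rational.Unnormalised.Properties as ℚ
open import Data.Sum as Sum using (_⊎_; inj₁; inj₂)
open import Data.Vec using (Vec; []; _∷_; _∷ʳ_)
open import Data.Vec.Properties
  using (tabulate-cong; ≡-dec; ∷-injectiveʳ; ∷ʳ-injectiveˡ; ∷ʳ-injectiveʳ)
open import Function using (_∘_; _⇔_; mk⇔; Equivalence; const)
open import Level using (0ℓ)
open import Relation.Binary using (DecidableEquality; tri<; tri≈; tri>)
open import Relation.Binary.Construct.Closure.ReflexiveTransitive using (Star; ε; _◅_)
open import Relation.Binary.PropositionalEquality
open import Relation.Nullary using (Dec; yes; no; ¬_; ¬?; contradiction)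
open import Relation.Nullary.Decidable
  using (_×-dec_; ⌊_⌋; does-⇔; decidable-stable; from-yes; toWitness; fromWitness)
open import Relation.Unary using (Pred; Decidable)

-- Finite sums over lists

∑ : {A : Set} → List A → (A → ℕ) → ℕ
∑ xs f = sum (map f xs)

private variable
  A B : Set

∑-mono : ∀ (xs : List A) {f g} → (∀ x → f x ≤ g x) → ∑ xs f ≤ ∑ xs g
∑-mono []       f≤g = z≤n
∑-mono (x ∷ xs) f≤g = ℕ.+-mono-≤ (f≤g x) (∑-mono xs f≤g)

∑-const : ∀ (xs : List A) c → ∑ xs (const c) ≡ length xs ℕ.* c
∑-const []       c = refl
∑-const (x ∷ xs) c = cong (_ +_) (∑-const xs c)

∑-0 : ∀ (xs : List A) → ∑ xs (const 0) ≡ 0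
∑-0 xs = trans (∑-const xs 0) (ℕ.*-zeroʳ (length xs))

∑-+ : ∀ (xs : List A) f g → ∑ xs (λ x → f x + g x) ≡ ∑ xs f + ∑ xs g
∑-+ []       f g = refl
∑-+ (x ∷ xs) f g = trans (cong (_ +_) (∑-+ xs f g)) (interchange (f x) (g x) _ _)
  where
  interchange : ∀ a b c d → a + b + (c + d) ≡ a + c + (b + d)
  interchange = solve-∀

∑-* : ∀ c (xs : List A) f → ∑ xs (λ x → c ℕ.* f x) ≡ c ℕ.* ∑ xs f
∑-* c []       f = sym (ℕ.*-zeroʳ c)
∑-* c (x ∷ xs) f = trans (cong (_ +_) (∑-* c xs f)) (sym (ℕ.*-distribˡ-+ c _ _))

∑-swap : ∀ (xs : List A) (ys : List B) (f : A → B → ℕ) →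
  ∑ xs (λ x → ∑ ys (f x)) ≡ ∑ ys (λ y → ∑ xs (λ x → f x y))
∑-swap []       ys f = sym (∑-0 ys)
∑-swap (x ∷ xs) ys f = trans (cong (_ +_) (∑-swap xs ys f)) (sym (∑-+ ys (f x) _))

f[x]≤∑ : ∀ {xs : List A} {x} f → x List.∈ xs → f x ≤ ∑ xs f
f[x]≤∑ f (here refl) = ℕ.m≤m+n _ _
f[x]≤∑ f (there x∈)  = ℕ.≤-trans (f[x]≤∑ f x∈) (ℕ.m≤n+m _ _)

-- The averaging argument: if `f x ≥ g x` held throughout the list, the sums would compare the same
-- way. It later extracts one random string from a bound on a total over all strings.
∑-<⇒∃ : ∀ (xs : List A) {f g} → ∑ xs f ℕ.< ∑ xs g → ∃ λ x → f x ℕ.< g x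
∑-<⇒∃ (x ∷ xs) {f} {g} ∑f<∑g with f x ℕ.<? g x
... | yes f<g = x , f<g
... | no  f≮g = ∑-<⇒∃ xs (ℕ.+-cancelˡ-< (f x) _ _
                  (ℕ.<-≤-trans ∑f<∑g (ℕ.+-monoˡ-≤ _ (ℕ.≮⇒≥ f≮g))))

-- Indicators and counting with multiplicity

𝟙 : {P : Set} → Dec P → ℕ
𝟙 (yes _) = 1
𝟙 (no  _) = 0

𝟙-yes : ∀ {P : Set} (P? : Dec P) → P → 𝟙 P? ≡ 1
𝟙-yes (yes _) p = refl
𝟙-yes (no ¬p) p = contradiction p ¬p

𝟙≡0⇒¬ : ∀ {P : Set} (P? : Dec P) → 𝟙 P? ≡ 0 → ¬ P
𝟙≡0⇒¬ (no ¬p) _ = ¬p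

AtMostOne : Pred A 0ℓ → Set
AtMostOne P = ∀ {x y} → P x → P y → x ≡ y

∑𝟙≡0 : ∀ {P : Pred A 0ℓ} (P? : Decidable P) {xs} → All (¬_ ∘ P) xs → ∑ xs (𝟙 ∘ P?) ≡ 0
∑𝟙≡0 P? [] = refl
∑𝟙≡0 P? {x ∷ _} (¬p ∷ ¬ps) with P? x
... | yes p = contradiction p ¬p
... | no  _ = ∑𝟙≡0 P? ¬ps

∑𝟙≤1 : ∀ {P : Pred A 0ℓ} (P? : Decidable P) → AtMostOne P → ∀ {xs} → Unique xs →
  ∑ xs (𝟙 ∘ P?) ≤ 1
∑𝟙≤1 P? amo [] = z≤n
∑𝟙≤1 P? amo {x ∷ _} (x∉xs ∷ xs!) with P? x
... | yes p = ℕ.≤-reflexive (cong suc (∑𝟙≡0 P? (All.map (λ x≢y q → x≢y (amo p q)) x∉xs)))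
... | no  _ = ∑𝟙≤1 P? amo xs!

module Multiplicity (_≟_ : DecidableEquality A) where

  open import Data.List.Membership.DecPropositional _≟_ public using () renaming (_∈?_ to _∈ₗ?_)

  -- For a duplicate-free `ys` this is the 0/1 indicator of membership, so sizes of sets of strings
  -- become sums over all strings.
  multiplicity : List A → A → ℕ
  multiplicity ys x = ∑ ys (λ y → 𝟙 (x ≟ y))

  multiplicity≤1 : ∀ {ys} x → Unique ys → multiplicity ys x ≤ 1
  multiplicity≤1 x = ∑𝟙≤1 (x ≟_) (λ p q → trans (sym p) q)

  multiplicity≡0 : ∀ {ys x} → ¬ x List.∈ ys → multiplicity ys x ≡ 0
  multiplicity≡0 {x = x} x∉ys = ∑𝟙≡0 (x ≟_) (All.¬Any⇒All¬ _ x∉ys)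

  -- Double counting: since `xs` contains every element, each entry `y` of `ys` is counted at least
  -- once, at `x = y`.
  length≤∑multiplicity : ∀ {xs} → (∀ x → x List.∈ xs) → ∀ ys →
    length ys ≤ ∑ xs (multiplicity ys)
  length≤∑multiplicity {xs} x∈xs ys = begin
    length ys                               ≡⟨ ℕ.*-identityʳ _ ⟨
    length ys ℕ.* 1                         ≡⟨ ∑-const ys 1 ⟨
    ∑ ys (const 1)                          ≤⟨ ∑-mono ys (λ y → ℕ.≤-trans
                                                 (ℕ.≤-reflexive (sym (𝟙-yes (y ≟ y) refl)))
                                                 (f[x]≤∑ (λ x → 𝟙 (x ≟ y)) (x∈xs y))) ⟩
    ∑ ys (λ y → ∑ xs (λ x → 𝟙 (x ≟ y)))     ≡⟨ ∑-swap ys xs (λ y x → 𝟙 (x ≟ y)) ⟩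
    ∑ xs (multiplicity ys)                  ∎
    where open ℕ.≤-Reasoning hiding (start)

-- Random strings

allVecs : ∀ t → List (Vec Bool t)
allVecs zero    = [] ∷ []
allVecs (suc t) = map (true ∷_) (allVecs t) ++ map (false ∷_) (allVecs t)

∈-allVecs : ∀ {t} (r : Vec Bool t) → r List.∈ allVecs t
∈-allVecs []          = here refl
∈-allVecs (true  ∷ r) = ∈-++⁺ˡ (∈-map⁺ (true ∷_) (∈-allVecs r))
∈-allVecs (false ∷ r) = ∈-++⁺ʳ _ (∈-map⁺ (false ∷_) (∈-allVecs r))

length-two-maps : ∀ (f g : A → B) xs → length (map f xs ++ map g xs) ≡ 2 ℕ.* length xs
length-two-maps f g xs = begin
  length (map f xs ++ map g xs)          ≡⟨ length-++ (map f xs) ⟩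
  length (map f xs) + length (map g xs) ≡⟨ cong₂ _+_ (length-map f xs) (length-map g xs) ⟩
  length xs + length xs                ≡⟨ cong (length xs +_) (ℕ.+-identityʳ _) ⟨
  2 ℕ.* length xs                        ∎
  where open ≡-Reasoning

unique-two-maps : ∀ {f g : A → B} → (∀ {x y} → f x ≡ f y → x ≡ y) →
  (∀ {x y} → g x ≡ g y → x ≡ y) → (∀ {x y} → f x ≢ g y) →
  ∀ {xs} → Unique xs → Unique (map f xs ++ map g xs)
unique-two-maps {f = f} {g} f-inj g-inj f≢g xs! =
  Unique.++⁺ (Unique.map⁺ f-inj xs!) (Unique.map⁺ g-inj xs!)
    λ (v∈f , v∈g) → f≢g (trans (sym (proj₂ (proj₂ (∈-map⁻ f v∈f)))) (proj₂ (proj₂ (∈-map⁻ g v∈g))))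

length-allVecs : ∀ t → length (allVecs t) ≡ 2 ^ t
length-allVecs zero    = refl
length-allVecs (suc t) = trans (length-two-maps _ _ (allVecs t)) (cong (2 ℕ.*_) (length-allVecs t))

∑1-allVecs : ∀ t → ∑ (allVecs t) (const 1) ≡ 2 ^ t
∑1-allVecs t = trans (∑-const (allVecs t) 1) (trans (ℕ.*-identityʳ _) (length-allVecs t))

allVecs! : ∀ t → Unique (allVecs t)
allVecs! zero    = [] ∷ []
allVecs! (suc t) = unique-two-maps ∷-injectiveʳ ∷-injectiveʳ (λ ()) (allVecs! t)

-- Clears denominators. `mkℚᵘ` stores the denominator minus one, hence `suc b`.
scaled-≤⇔ : ∀ a b x y → (mkℚᵘ (ℤ.+ a) b ℚ.* fromℕ x ℚ.≤ fromℕ y) ⇔ (a ℕ.* x ≤ suc b ℕ.* y)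
scaled-≤⇔ a b x y = mk⇔
  (λ { (*≤* le) → ℤ.drop‿+≤+ (subst₂ ℤ._≤_ lhs rhs le) })
  (λ le → *≤* (subst₂ ℤ._≤_ (sym lhs) (sym rhs) (ℤ.+≤+ le)))
  where
  lhs : (ℤ.+ a ℤ.* ℤ.+ x) ℤ.* ℤ.+ 1 ≡ ℤ.+ (a ℕ.* x)
  lhs = trans (ℤ.*-identityʳ _) (sym (ℤ.pos-* a x))
  rhs : ℤ.+ y ℤ.* ℤ.+ (suc b ℕ.* 1) ≡ ℤ.+ (suc b ℕ.* y)
  rhs = trans (sym (ℤ.pos-* y (suc b ℕ.* 1)))
    (cong ℤ.+_ (trans (cong (y ℕ.*_) (ℕ.*-identityʳ (suc b))) (ℕ.*-comm y (suc b))))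

module _ {n} (G : Graph n) (A : Algorithm n) where

  open Algorithm A
  open Run G A using (resultFrom)

  -- Bits are read from the front, so a run that has already halted never reaches the appended bit.
  resultFrom-∷ʳ : ∀ {P : Pred (List (Subset n)) 0ℓ} {t} s (r : Vec Bool t) b →
    Maybe.Any P (resultFrom s r) → Maybe.Any P (resultFrom s (r ∷ʳ b))
  resultFrom-∷ʳ s (c ∷ r) b p with step s
  ... | halt _   = p
  ... | toss k   = resultFrom-∷ʳ (k c) r b p
  ... | pre S k  = resultFrom-∷ʳ (k (Pre G S)) r b p
  ... | post S k = resultFrom-∷ʳ (k (Post G S)) r b p

  -- Correct with probability at least 5/8: any constant strictly between 1/2
  -- and 2/3 makes success on two graphs overlap.
  ProbCorrect : ℕ → Set
  ProbCorrect t = ∃ λ (rs : List (Vec Bool t)) →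
    Unique rs × All (Correct G A) rs × 5 ℕ.* 2 ^ t ≤ 8 ℕ.* length rs

  -- Both one-bit extensions of a correct string are correct, so the number of correct strings and
  -- the number of all strings double together.
  probCorrect-suc : ∀ {t} → ProbCorrect t → ProbCorrect (suc t)
  probCorrect-suc {t} (rs , rs! , correct , bound) =
    map (_∷ʳ true) rs ++ map (_∷ʳ false) rs ,
    unique-two-maps {f = _∷ʳ true} {_∷ʳ false}
      (λ {x} {y} → ∷ʳ-injectiveˡ x y) (λ {x} {y} → ∷ʳ-injectiveˡ x y)
      (λ {x} {y} eq → contradiction (∷ʳ-injectiveʳ x y eq) λ ()) rs! ,
    All.++⁺ (extend true) (extend false) ,
    bound′
    where
    extend : ∀ b → All (Correct G A) (map (_∷ʳ b) rs)
    extend b = All.map⁺ (All.map (λ {r} → resultFrom-∷ʳ start r b) correct)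
    swap : ∀ a b c → a ℕ.* (b ℕ.* c) ≡ b ℕ.* (a ℕ.* c)
    swap = solve-∀
    open ℕ.≤-Reasoning hiding (start)
    bound′ : 5 ℕ.* 2 ^ suc t ≤ 8 ℕ.* length (map (_∷ʳ true) rs ++ map (_∷ʳ false) rs)
    bound′ = begin
      5 ℕ.* 2 ^ suc t            ≡⟨ swap 5 2 (2 ^ t) ⟩
      2 ℕ.* (5 ℕ.* 2 ^ t)        ≤⟨ ℕ.*-monoʳ-≤ 2 bound ⟩
      2 ℕ.* (8 ℕ.* length rs)    ≡⟨ swap 2 8 (length rs) ⟩
      8 ℕ.* (2 ℕ.* length rs)    ≡⟨ cong (8 ℕ.*_) (length-two-maps _ _ rs) ⟨
      8 ℕ.* length (map (_∷ʳ true) rs ++ map (_∷ʳ false) rs) ∎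

  probCorrect-mono : ∀ {t t′} → t ≤′ t′ → ProbCorrect t → ProbCorrect t′
  probCorrect-mono ≤′-refl        = λ p → p
  probCorrect-mono (≤′-step t≤t′) = probCorrect-suc ∘ probCorrect-mono t≤t′

-- Bounded error supplies every `p` below 2/3, in particular 5/8. The resulting string length
-- depends on `G`.
boundedError⇒probCorrect : ∀ {n} {A : Algorithm n} → BoundedError A → ∀ G → ∃ (ProbCorrect G A)
boundedError⇒probCorrect bounded G with bounded G (ℤ.+ 5 / 8) (from-yes (ℤ.+ 5 / 8 ℚ.<? ℤ.+ 2 / 3))
... | t , rs , rs! , correct , bound =
  t , rs , rs! , correct , Equivalence.to (scaled-≤⇔ 5 7 (2 ^ t) (length rs)) bound

alwaysCorrect⇒probCorrect : ∀ {n} {A : Algorithm n} → AlwaysCorrect A → ∀ G → ∃ (ProbCorrect G A)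
alwaysCorrect⇒probCorrect always G with always G
... | t , correct = t , allVecs t , allVecs! t , All.universal correct _ ,
  ℕ.*-mono-≤ (ℕ.m≤m+n 5 3) (ℕ.≤-reflexive (sym (length-allVecs t)))

-- Separating a graph from many variants

_≟ₛ_ : ∀ {n} → DecidableEquality (Subset n)
_≟ₛ_ = ≡-dec Bool._≟_

module _ {n k} (G : Graph n) (H : Fin k → Graph n) (A : Algorithm n) where

  open Algorithm A

  separatesPre? : ∀ S i → Dec (Pre (H i) S ≢ Pre G S)
  separatesPre? S i = ¬? (Pre (H i) S ≟ₛ Pre G S)

  separatesPost? : ∀ S i → Dec (Post (H i) S ≢ Post G S)
  separatesPost? S i = ¬? (Post (H i) S ≟ₛ Post G S)

  -- Only the run on `G` is followed. Every operation whose answer on `H i` would differ counts,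
  -- including those after the first.
  separations : ∀ {t} → State → Vec Bool t → Fin k → ℕ
  separations s []      i = 0
  separations s (b ∷ r) i with step s
  ... | halt _    = 0
  ... | toss κ    = separations (κ b) r i
  ... | pre S κ   = 𝟙 (separatesPre? S i) + separations (κ (Pre G S)) r i
  ... | post S κ  = 𝟙 (separatesPost? S i) + separations (κ (Post G S)) r i

  -- If all answers agree, the runs on `G` and on `H i` pass through the same states.
  resultFrom-unseparated : ∀ {t} s (r : Vec Bool t) i → separations s r i ≡ 0 →
    Run.resultFrom (H i) A s r ≡ Run.resultFrom G A s r
  resultFrom-unseparated s []      i _ = refl
  resultFrom-unseparated s (b ∷ r) i none with step s
  ... | halt _   = refl
  ... | toss κ   = resultFrom-unseparated (κ b) r i none
  -- A zero indicator refutes the inequality of the answers; decidable equality of subsets removes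
  -- the double negation.
  ... | pre S κ
    rewrite decidable-stable (Pre (H i) S ≟ₛ Pre G S)
              (𝟙≡0⇒¬ (separatesPre? S i) (ℕ.m+n≡0⇒m≡0 _ none))
    = resultFrom-unseparated (κ (Pre G S)) r i (ℕ.m+n≡0⇒n≡0 (𝟙 (separatesPre? S i)) none)
  ... | post S κ
    rewrite decidable-stable (Post (H i) S ≟ₛ Post G S)
              (𝟙≡0⇒¬ (separatesPost? S i) (ℕ.m+n≡0⇒m≡0 _ none))
    = resultFrom-unseparated (κ (Post G S)) r i (ℕ.m+n≡0⇒n≡0 (𝟙 (separatesPost? S i)) none)

  module _ (pre-separates  : ∀ S → AtMostOne (λ i → Pre (H i) S ≢ Pre G S))
           (post-separates : ∀ S → AtMostOne (λ i → Post (H i) S ≢ Post G S)) where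

    -- By the two hypotheses, each operation of the run adds at most one to the sum over all `i`.
    ∑separations≤operations : ∀ {t} s (r : Vec Bool t) →
      ∑ (allFin k) (separations s r) ≤ Run.operationsFrom G A s r
    ∑separations≤operations s [] =
      ℕ.≤-reflexive (∑-0 (allFin k))
    ∑separations≤operations s (b ∷ r) with step s
    ... | halt _   =
      ℕ.≤-reflexive (∑-0 (allFin k))
    ... | toss κ   = ∑separations≤operations (κ b) r
    ... | pre S κ  = ℕ.≤-trans (ℕ.≤-reflexive (∑-+ (allFin k) _ _))
      (ℕ.+-mono-≤ (∑𝟙≤1 (separatesPre? S) (pre-separates S) (Unique.allFin⁺ k))
                  (∑separations≤operations (κ (Pre G S)) r))
    ... | post S κ = ℕ.≤-trans (ℕ.≤-reflexive (∑-+ (allFin k) _ _))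
      (ℕ.+-mono-≤ (∑𝟙≤1 (separatesPost? S) (post-separates S) (Unique.allFin⁺ k))
                  (∑separations≤operations (κ (Post G S)) r))

    module _ (different : ∀ i {Cs} → EnumeratesSCCs G Cs → ¬ EnumeratesSCCs (H i) Cs) where

      -- Without a separation the two runs would return the same list, which would then enumerate
      -- the SCCs of both graphs.
      correct-separates : ∀ {t} (r : Vec Bool t) i → Correct G A r → Correct (H i) A r →
        1 ≤ separations start r i
      correct-separates r i correct correctᵢ = ℕ.n≢0⇒n>0 λ none →
        let Cs , enum , enumᵢ = Maybe.satisfied (Maybe.zip
              (correct , subst (Maybe.Any _) (resultFrom-unseparated start r i none) correctᵢ))
        in different i enum enumᵢ

      -- Inclusion-exclusion: two sets that each hold at least 5/8 of the strings share at least 5/8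
      -- + 5/8 - 1 = 1/4 of them, and each shared string separates.
      many-separate : ∀ {t} i → ProbCorrect G A t → ProbCorrect (H i) A t →
        2 ^ t ≤ 4 ℕ.* ∑ (allVecs t) (λ r → separations start r i)
      many-separate {t} i (rs , rs! , correct , bound) (rsᵢ , rsᵢ! , correctᵢ , boundᵢ) =
        cancel {2 ^ t} {length rs} {length rsᵢ} bound boundᵢ (begin
          length rs + length rsᵢ
            ≤⟨ ℕ.+-mono-≤ (length≤∑multiplicity ∈-allVecs rs) (length≤∑multiplicity ∈-allVecs rsᵢ) ⟩
          ∑ (allVecs t) (multiplicity rs) + ∑ (allVecs t) (multiplicity rsᵢ)
            ≡⟨ ∑-+ (allVecs t) _ _ ⟨
          ∑ (allVecs t) (λ r → multiplicity rs r + multiplicity rsᵢ r)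
            ≤⟨ ∑-mono (allVecs t) shared ⟩
          ∑ (allVecs t) (λ r → 1 + separations start r i)
            ≡⟨ ∑-+ (allVecs t) (const 1) _ ⟩
          ∑ (allVecs t) (const 1) + ∑ (allVecs t) (λ r → separations start r i)
            ≡⟨ cong (_+ ∑ (allVecs t) (λ r → separations start r i)) (∑1-allVecs t) ⟩
          2 ^ t + ∑ (allVecs t) (λ r → separations start r i) ∎)
        where
        open Multiplicity (≡-dec {n = t} Bool._≟_)
        open ℕ.≤-Reasoning hiding (start)
        -- Both multiplicities are at most 1, so their sum exceeds 1 only for a string in both
        -- lists.
        shared : ∀ r → multiplicity rs r + multiplicity rsᵢ r ≤ 1 + separations start r i
        shared r with r ∈ₗ? rs | r ∈ₗ? rsᵢ
        ... | yes r∈ | yes r∈ᵢ = ℕ.+-mono-≤ (multiplicity≤1 r rs!) (ℕ.≤-trans (multiplicity≤1 r rsᵢ!)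
                                   (correct-separates r i (All.lookup correct r∈) (All.lookup correctᵢ r∈ᵢ)))
        ... | no  r∉ | _       rewrite multiplicity≡0 r∉ = ℕ.≤-trans (multiplicity≤1 r rsᵢ!) (s≤s z≤n)
        ... | yes _  | no  r∉ᵢ = ℕ.+-mono-≤ (multiplicity≤1 r rs!)
                                   (ℕ.≤-trans (ℕ.≤-reflexive (multiplicity≡0 r∉ᵢ)) z≤n)
        -- 10N ≤ 8(a + b) ≤ 8N + 8d, hence 2N ≤ 8d.
        cancel : ∀ {N a b d} → 5 ℕ.* N ≤ 8 ℕ.* a → 5 ℕ.* N ≤ 8 ℕ.* b → a + b ≤ N + d →
          N ≤ 4 ℕ.* d
        cancel {N} {a} {b} {d} N≤a N≤b a+b≤N+d =
          ℕ.*-cancelˡ-≤ 2 (ℕ.+-cancelˡ-≤ (8 ℕ.* N) _ _ (begin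
            8 ℕ.* N + 2 ℕ.* N          ≡⟨ left N ⟩
            5 ℕ.* N + 5 ℕ.* N          ≤⟨ ℕ.+-mono-≤ N≤a N≤b ⟩
            8 ℕ.* a + 8 ℕ.* b          ≡⟨ ℕ.*-distribˡ-+ 8 a b ⟨
            8 ℕ.* (a + b)              ≤⟨ ℕ.*-monoʳ-≤ 8 a+b≤N+d ⟩
            8 ℕ.* (N + d)              ≡⟨ right N d ⟩
            8 ℕ.* N + 2 ℕ.* (4 ℕ.* d)  ∎))
          where
          left : ∀ N → 8 ℕ.* N + 2 ℕ.* N ≡ 5 ℕ.* N + 5 ℕ.* N
          left = solve-∀
          right : ∀ N d → 8 ℕ.* (N + d) ≡ 8 ℕ.* N + 2 ℕ.* (4 ℕ.* d)
          right = solve-∀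

      -- Summing the previous bound over `i` and exchanging the sums compares `k` with four times
      -- the average number of operations on `G`.
      many-operations : ∀ {t} → ProbCorrect G A t → (∀ i → ProbCorrect (H i) A t) →
        ∃ λ (r : Vec Bool t) → k ≤ 4 ℕ.* operations G A r
      many-operations {t} prob probᵢ with ∑-<⇒∃ R (begin-strict
          ∑ R (const k)
            ≡⟨ trans (∑-const R k) (ℕ.*-comm (length R) k) ⟩
          k ℕ.* length R
            ≡⟨ cong₂ ℕ._*_ (sym (length-tabulate {n = k} (λ i → i))) (length-allVecs t) ⟩
          length (allFin k) ℕ.* 2 ^ t
            ≡⟨ ∑-const (allFin k) (2 ^ t) ⟨
          ∑ (allFin k) (const (2 ^ t))
            ≤⟨ ∑-mono (allFin k) (λ i → many-separate i prob (probᵢ i)) ⟩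
          ∑ (allFin k) (λ i → 4 ℕ.* ∑ R (λ r → separations start r i))
            ≡⟨ ∑-* 4 (allFin k) _ ⟩
          4 ℕ.* ∑ (allFin k) (λ i → ∑ R (λ r → separations start r i))
            ≡⟨ cong (4 ℕ.*_) (∑-swap (allFin k) R _) ⟩
          4 ℕ.* ∑ R (λ r → ∑ (allFin k) (separations start r))
            ≤⟨ ℕ.*-monoʳ-≤ 4 (∑-mono R (∑separations≤operations start)) ⟩
          4 ℕ.* ∑ R (operations G A)
            ≡⟨ ∑-* 4 R _ ⟨
          ∑ R (λ r → 4 ℕ.* operations G A r)
            -- The extra 1 per string makes the inequality strict, as the averaging step requires;
            -- `k < 1 + 4q` then gives `k ≤ 4q`.
            <⟨ ℕ.m<n+m _ {∑ R (const 1)} positive ⟩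
          ∑ R (const 1) + ∑ R (λ r → 4 ℕ.* operations G A r)
            ≡⟨ ∑-+ R (const 1) _ ⟨
          ∑ R (λ r → 1 + 4 ℕ.* operations G A r) ∎)
        where
        R = allVecs t
        positive : 0 ℕ.< ∑ R (const 1)
        positive = subst (0 ℕ.<_) (sym (∑1-allVecs t)) (ℕ.m^n>0 2 t)
        open ℕ.≤-Reasoning hiding (start)
      ... | r , s≤s k≤ = r , k≤

      operations-lower-bound : (∀ G′ → ∃ (ProbCorrect G′ A)) →
        ∃₂ λ t (r : Vec Bool t) → k ≤ 4 ℕ.* operations G A r
      operations-lower-bound prob = t , many-operations
        (extend G (ℕ.m≤m+n _ _))
        (λ i → extend (H i) (ℕ.≤-trans (f[x]≤∑ (time ∘ H) (∈-allFin i)) (ℕ.m≤n+m _ (time G))))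
        where
        time : Graph n → ℕ
        time G′ = proj₁ (prob G′)
        -- A common string length for `G` and all `H i`: the sum bounds each of the individual
        -- times.
        t = time G + ∑ (allFin k) (time ∘ H)
        extend : ∀ G′ → time G′ ≤ t → ProbCorrect G′ A t
        extend G′ le = probCorrect-mono G′ A (ℕ.≤⇒≤′ le) (proj₂ (prob G′))

-- The hard instances

addEdge : ∀ {n} → Fin n → Fin n → Graph n → Graph n
addEdge a b G u v = G u v ∨ (⌊ u Fin.≟ a ⌋ ∧ ⌊ v Fin.≟ b ⌋)

module _ {n} (a b : Fin n) (G : Graph n) where

  edge⁺ : ∀ {u v} → Edge G u v → Edge (addEdge a b G) u v
  edge⁺ e = Equivalence.from T-∨ (inj₁ e)

  newEdge : Edge (addEdge a b G) a b
  newEdge = Equivalence.from (T-∨ {G a b}) (inj₂ (Equivalence.from T-∧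
    (fromWitness {a? = a Fin.≟ a} refl , fromWitness {a? = b Fin.≟ b} refl)))

  edge⁻ : ∀ {u v} → Edge (addEdge a b G) u v → Edge G u v ⊎ (u ≡ a × v ≡ b)
  edge⁻ {u} {v} e with Equivalence.to (T-∨ {G u v}) e
  ... | inj₁ old = inj₁ old
  ... | inj₂ new with Equivalence.to (T-∧ {⌊ u Fin.≟ a ⌋}) new
  ...   | u≡a , v≡b = inj₂ (toWitness {a? = u Fin.≟ a} u≡a , toWitness {a? = v Fin.≟ b} v≡b)

-- The new edge can add only `b` to the answer, and only if `a ∈ S`; `covered` says that an old edge
-- already reaches `b` in that case.
Post-addEdge : ∀ {n} (a b : Fin n) G {S} → (a ∈ S → ∃ λ s → s ∈ S × Edge G s b) →
  Post (addEdge a b G) S ≡ Post G S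
Post-addEdge a b G {S} covered = tabulate-cong λ v → does-⇔
  (mk⇔ (λ (s , s∈S , e) → old s∈S (edge⁻ a b G e)) (λ (s , s∈S , e) → s , s∈S , edge⁺ a b G e))
  (any? λ s → (s ∈? S) ×-dec T? (addEdge a b G s v))
  (any? λ s → (s ∈? S) ×-dec T? (G s v))
  where
  old : ∀ {s v} → s ∈ S → Edge G s v ⊎ (s ≡ a × v ≡ b) → ∃ λ s → s ∈ S × Edge G s v
  old s∈S (inj₁ e)             = _ , s∈S , e
  old a∈S (inj₂ (refl , refl)) = covered a∈S

Pre-addEdge : ∀ {n} (a b : Fin n) G {S} → (b ∈ S → ∃ λ s → s ∈ S × Edge G a s) →
  Pre (addEdge a b G) S ≡ Pre G S
Pre-addEdge a b G {S} covered = tabulate-cong λ v → does-⇔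
  (mk⇔ (λ (s , s∈S , e) → old s∈S (edge⁻ a b G e)) (λ (s , s∈S , e) → s , s∈S , edge⁺ a b G e))
  (any? λ s → (s ∈? S) ×-dec T? (addEdge a b G v s))
  (any? λ s → (s ∈? S) ×-dec T? (G v s))
  where
  old : ∀ {s v} → s ∈ S → Edge G v s ⊎ (v ≡ a × s ≡ b) → ∃ λ s → s ∈ S × Edge G v s
  old s∈S (inj₁ e)             = _ , s∈S , e
  old b∈S (inj₂ (refl , refl)) = covered b∈S

-- The self-loops matter: without them, `S` = {i + 1, i + 2} would let one `Post` separate the back
-- edges out of both i + 1 and i + 2.
tournament : ∀ n → Graph n
tournament n u v = ⌊ u Fin.≤? v ⌋

≤⇒edge : ∀ {n} {u v : Fin n} → u Fin.≤ v → Edge (tournament n) u v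
≤⇒edge {u = u} {v} = fromWitness {a? = u Fin.≤? v}

edge⇒≤ : ∀ {n} {u v : Fin n} → Edge (tournament n) u v → u Fin.≤ v
edge⇒≤ {u = u} {v} = toWitness {a? = u Fin.≤? v}

-- `Fin k` indexes the consecutive pairs among `suc k` vertices: `inject₁ i` is vertex i and `suc i`
-- is vertex i + 1.
withBackEdge : ∀ {k} → Fin k → Graph (suc k)
withBackEdge i = addEdge (suc i) (inject₁ i) (tournament _)

atMostOne-by-< : ∀ {k} {P : Pred (Fin k) 0ℓ} →
  (∀ {i j} → i Fin.< j → P i → ¬ P j) → AtMostOne P
atMostOne-by-< excl {i} {j} pi pj with Fin.<-cmp i j
... | tri< i<j _ _ = contradiction pj (excl i<j pi)
... | tri≈ _ i≡j _ = i≡j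
... | tri> _ _ j<i = contradiction pi (excl j<i pj)

-- Equality holds when j = i + 1; the edge obtained from it is then a self-loop.
suc≤inject₁ : ∀ {k} {i j : Fin k} → i Fin.< j → suc i Fin.≤ inject₁ j
suc≤inject₁ {j = j} i<j = subst (_ ℕ.≤_) (sym (Fin.toℕ-inject₁ j)) i<j

Post-withBackEdge : ∀ {k} (i : Fin k) {S} → (suc i ∈ S → ∃ λ s → s ∈ S × s Fin.≤ inject₁ i) →
  Post (withBackEdge i) S ≡ Post (tournament _) S
Post-withBackEdge i covered = Post-addEdge (suc i) (inject₁ i) (tournament _) λ 1+i∈S →
  let s , s∈S , s≤i = covered 1+i∈S in s , s∈S , ≤⇒edge s≤i

Pre-withBackEdge : ∀ {k} (i : Fin k) {S} → (inject₁ i ∈ S → ∃ λ s → s ∈ S × suc i Fin.≤ s) →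
  Pre (withBackEdge i) S ≡ Pre (tournament _) S
Pre-withBackEdge i covered = Pre-addEdge (suc i) (inject₁ i) (tournament _) λ i∈S →
  let s , s∈S , i<s = covered i∈S in s , s∈S , ≤⇒edge i<s

-- If `i < j` and `i` is separated, then `suc i ∈ S`. This vertex has an edge to `inject₁ j`, the
-- head of the later back edge, so `j` is not separated.
postSeparates-atMostOne : ∀ {k} (S : Subset (suc k)) →
  AtMostOne (λ i → Post (withBackEdge i) S ≢ Post (tournament _) S)
postSeparates-atMostOne S = atMostOne-by-< λ {i} {j} i<j i-sep j-sep →
  i-sep (Post-withBackEdge i λ 1+i∈S → contradiction
    (Post-withBackEdge j λ _ → suc i , 1+i∈S , suc≤inject₁ i<j) j-sep)

-- Dually, separating `j` forces `inject₁ j ∈ S`, and the tail `suc i` of the earlier back edge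
-- already has an edge to it.
preSeparates-atMostOne : ∀ {k} (S : Subset (suc k)) →
  AtMostOne (λ i → Pre (withBackEdge i) S ≢ Pre (tournament _) S)
preSeparates-atMostOne S = atMostOne-by-< λ {i} {j} i<j i-sep j-sep →
  j-sep (Pre-withBackEdge j λ j∈S → contradiction
    (Pre-withBackEdge i λ _ → inject₁ j , j∈S , suc≤inject₁ i<j) i-sep)

-- Strongly connected components of the tournament

module _ {n} (G : Graph n) where

  ⁅⁆-stronglyConnected : ∀ x → StronglyConnected G ⁅ x ⁆
  ⁅⁆-stronglyConnected x u∈ v∈ with x∈⁅y⁆⇒x≡y x u∈ | x∈⁅y⁆⇒x≡y x v∈
  ... | refl | refl = ε

  ⁅⁆-diameter : ∀ x → IsDiameter G ⁅ x ⁆ 0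
  ⁅⁆-diameter x = (x , x , x∈⁅x⁆ x , x∈⁅x⁆ x , (ε , refl) , λ _ → z≤n) , bounded
    where
    bounded : ∀ {u v d} → u ∈ ⁅ x ⁆ → v ∈ ⁅ x ⁆ → IsDistance (InducedEdge G ⁅ x ⁆) u v d → d ≤ 0
    bounded u∈ v∈ (_ , shortest) with x∈⁅y⁆⇒x≡y x u∈ | x∈⁅y⁆⇒x≡y x v∈
    ... | refl | refl = shortest ε

module _ (n : ℕ) where

  path⇒≤ : ∀ {C} {u v : Fin n} → Star (InducedEdge (tournament n) C) u v → u Fin.≤ v
  path⇒≤ ε                  = ℕ.≤-refl
  path⇒≤ ((_ , _ , e) ◅ es) = ℕ.≤-trans (edge⇒≤ e) (path⇒≤ es)

  -- Paths in the tournament never descend, so mutually reachable vertices coincide by antisymmetry.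
  stronglyConnected-≡ : ∀ {C x y} → StronglyConnected (tournament n) C → x ∈ C → y ∈ C → y ≡ x
  stronglyConnected-≡ sc x∈C y∈C = Fin.≤-antisym (path⇒≤ (sc y∈C x∈C)) (path⇒≤ (sc x∈C y∈C))

  stronglyConnected⊆⁅⁆ : ∀ {C x} → StronglyConnected (tournament n) C → x ∈ C →
    ∀ {y} → y ∈ C → y ∈ ⁅ x ⁆
  stronglyConnected⊆⁅⁆ {x = x} sc x∈C y∈C =
    subst (_∈ ⁅ x ⁆) (sym (stronglyConnected-≡ sc x∈C y∈C)) (x∈⁅x⁆ x)

  ⁅⁆-isSCC : ∀ x → IsSCC (tournament n) ⁅ x ⁆
  ⁅⁆-isSCC x = (x , x∈⁅x⁆ x) , ⁅⁆-stronglyConnected _ x ,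
    λ C′ sc x⊆C′ → stronglyConnected⊆⁅⁆ sc (x⊆C′ (x∈⁅x⁆ x))

  singletons : List (Subset n)
  singletons = map ⁅_⁆ (allFin n)

  singletons-enumerate : EnumeratesSCCs (tournament n) singletons
  singletons-enumerate C = mk⇔ to from
    where
    to : C List.∈ singletons → IsSCC (tournament n) C
    to C∈ with ∈-map⁻ ⁅_⁆ C∈
    ... | x , _ , refl = ⁅⁆-isSCC x
    from : IsSCC (tournament n) C → C List.∈ singletons
    from ((x , x∈C) , sc , _) = subst (List._∈ singletons)
      (⊆-antisym (λ y∈ → subst (_∈ C) (sym (x∈⁅y⁆⇒x≡y x y∈)) x∈C) (stronglyConnected⊆⁅⁆ sc x∈C))
      (∈-map⁺ ⁅_⁆ (∈-allFin x))

  -- All diameters are 0, so the parameter is just the number of components.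
  tournament-parameter : HasParameter (tournament n) n
  tournament-parameter = singletons , map (const 0) (allFin n) ,
    Unique.map⁺ (λ {x} {y} eq → x∈⁅y⁆⇒x≡y y (subst (x ∈_) eq (x∈⁅x⁆ x))) (Unique.allFin⁺ n) ,
    singletons-enumerate ,
    diameters (allFin n) ,
    sym (trans (cong₂ _+_ (trans (length-map ⁅_⁆ (allFin n)) (length-tabulate {n = n} (λ i → i)))
                            (∑-0 (allFin n)))
               (ℕ.+-identityʳ n))
    where
    diameters : ∀ xs → Pointwise (IsDiameter (tournament n)) (map ⁅_⁆ xs) (map (const 0) xs)
    diameters []       = []
    diameters (x ∷ xs) = ⁅⁆-diameter _ x ∷ diameters xs

-- Effect of a back edge on the components

x∈⁅a⁆∪⁅b⁆⁻ : ∀ {n x} (a b : Fin n) → x ∈ ⁅ a ⁆ ∪ ⁅ b ⁆ → x ≡ a ⊎ x ≡ b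
x∈⁅a⁆∪⁅b⁆⁻ a b = Sum.map (x∈⁅y⁆⇒x≡y a) (x∈⁅y⁆⇒x≡y b) ∘ x∈p∪q⁻ ⁅ a ⁆ ⁅ b ⁆

inject₁<suc : ∀ {k} (i : Fin k) → inject₁ i Fin.< suc i
inject₁<suc i = Fin.≤̄⇒inject₁< {i = i} ℕ.≤-refl

backEdge-stronglyConnected : ∀ {k} (i : Fin k) →
  StronglyConnected (withBackEdge i) (⁅ suc i ⁆ ∪ ⁅ inject₁ i ⁆)
backEdge-stronglyConnected i u∈ v∈
  with x∈⁅a⁆∪⁅b⁆⁻ (suc i) (inject₁ i) u∈ | x∈⁅a⁆∪⁅b⁆⁻ (suc i) (inject₁ i) v∈
... | inj₁ refl | inj₁ refl = ε
... | inj₂ refl | inj₂ refl = ε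
... | inj₁ refl | inj₂ refl = (u∈ , v∈ , newEdge (suc i) (inject₁ i) (tournament _)) ◅ ε
... | inj₂ refl | inj₁ refl =
  (u∈ , v∈ , edge⁺ (suc i) (inject₁ i) (tournament _)
    (≤⇒edge (ℕ.<⇒≤ (inject₁<suc i)))) ◅ ε

-- The singleton of `suc i` is a component of the tournament, but the back edge puts it inside a
-- larger strongly connected pair.
backEdge-different : ∀ {k} (i : Fin k) {Cs} →
  EnumeratesSCCs (tournament (suc k)) Cs → ¬ EnumeratesSCCs (withBackEdge i) Cs
backEdge-different i enum enumᵢ
  with Equivalence.to (enumᵢ ⁅ suc i ⁆) (Equivalence.from (enum ⁅ suc i ⁆) (⁅⁆-isSCC _ (suc i)))
... | _ , _ , maximal =
  Fin.<⇒≢ (inject₁<suc i) (x∈⁅y⁆⇒x≡y (suc i)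
    (maximal _ (backEdge-stronglyConnected i) (p⊆p∪q _) (q⊆p∪q ⁅ suc i ⁆ _ (x∈⁅x⁆ (inject₁ i)))))

-- Choice of constants and the lower bound

computesSCCs⇒probCorrect : ∀ {A} → ComputesSCCs A → ∀ n G → ∃ (ProbCorrect G (A n))
computesSCCs⇒probCorrect (inj₁ det)     n = alwaysCorrect⇒probCorrect (proj₂ (det n))
computesSCCs⇒probCorrect (inj₂ bounded) n = boundedError⇒probCorrect (bounded n)

theorem3p7 : ∃ λ (c : ℚᵘ) → 0ℚᵘ < c ×
    (∀ (A : ∀ n → Algorithm n) → ComputesSCCs A →
    ∀ (m : ℕ) → ∃₂ λ n (G : Graph n) → ∃ λ (g : ℕ) →
    HasParameter G g × m ≤ g × WorstCaseAtLeast G (A n) (c * fromℕ g))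
-- The constant 1/8 is the 1/4 from averaging times 1/2, which pays for having n - 1 back edges
-- against parameter n.
theorem3p7 = ℤ.+ 1 / 8 , from-yes (0ℚᵘ ℚ.<? ℤ.+ 1 / 8) , λ A computes m →
  -- At least two vertices, so that n ≤ 2(n - 1); the number of back edges is `suc m`.
  let n           = 2 + m
      t , r , k≤4 = operations-lower-bound (tournament n) withBackEdge (A n)
                      preSeparates-atMostOne postSeparates-atMostOne backEdge-different
                      (computesSCCs⇒probCorrect computes n)
  in n , tournament n , n , tournament-parameter n , ℕ.m≤n+m m 2 ,
     t , r , Equivalence.from (scaled-≤⇔ 1 7 n (operations (tournament n) (A n) r))
       (bound m (operations (tournament n) (A n) r) k≤4)
  where
  bound : ∀ m q → suc m ≤ 4 ℕ.* q → 1 ℕ.* (2 + m) ≤ 8 ℕ.* q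
  bound m q k≤4q = begin
    1 ℕ.* (2 + m)           ≤⟨ ℕ.m≤m+n _ m ⟩
    1 ℕ.* (2 + m) + m     ≡⟨ left m ⟩
    2 ℕ.* suc m               ≤⟨ ℕ.*-monoʳ-≤ 2 k≤4q ⟩
    2 ℕ.* (4 ℕ.* q)           ≡⟨ ℕ.*-assoc 2 4 q ⟨
    8 ℕ.* q                   ∎
    where
    open ℕ.≤-Reasoning hiding (start)
    left : ∀ m → 1 ℕ.* (2 + m) + m ≡ 2 ℕ.* suc m
    left = solve-∀
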